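{- Let $X$ be a metrizable Priestley space. Then $X$ is not dual to a bi-Heyting algebra if and only if at least one of the following holds: (a) one of $Z_1,Z_2,Z_3$ is a forbidden configuration for $X$, i.e. there are $i\in\{1,2,3\}$, a topological and order embedding $e\colon Z_i\to X$, and an open neighborhood $U$ of $e(y)$ such that $e^{ -1}({\downarrow}U)=\{x,y\}$; (b) there are $i\in\{1,2,3\}$, a topological and order embedding $e\colon Z_i^*\to X$, and an open neighborhood $U$ of $e(y)$ such that $e^{ -1}({\uparrow}U)=\{x,y\}$.
   Context: For a poset $X$ and $A\subseteq X$, ${\downarrow}A=\{x\mid x\le a\text{ for some }a\in A\}$ and ${\uparrow}A=\{x\mid a\le x\text{ for some }a\in A\}$; $A$ is an upset if ${\uparrow}A=A$. A Priestley space is a compact topological space $X$ with a partial order such that whenever $x\nleq y$ there is a clopen upset $U$ with $x\in U$, $y\notin U$. By Priestley duality, each Priestley space $X$ is the dual of the bounded distributive lattice of its clopen upsets. A bi-Heyting algebra is a lattice that is both a Heyting algebra and a co-Heyting algebra (the order-dual of a Heyting algebra); $X$ is dual to a bi-Heyting algebra when its lattice of clopen upsets is a bi-Heyting algebra, equivalently, when both the upset and the downset of each open subset of $X$ are open. The Priestley spaces $Z_1,Z_2,Z_3$ all have as underlying topological space the one-point compactification of the countable discrete space $\{y\}\cup\{z_n\mid n\in\omega\}$ (all points distinct), where $x$ is the added point. Their orders have exactly the following strict relations. - $Z_1$: $x<y$; $z_0>z_1>z_2>\cdots$; $x<z_n$ for all $n$. - $Z_2$: $x<y$ and $x<z_n$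 for all $n$. - $Z_3$: $x<y$ only. $Z_i^*$ is the Priestley space obtained from $Z_i$ by reversing the order. -}

module Defs where

open import Axiom.ExcludedMiddle using (ExcludedMiddle)
open import Data.Bool.Base using (true; false)
open import Data.Empty using () renaming (⊥ to Empty)
open import Data.Fin.Base using (Fin)
open import Data.Fin.Patterns using (0F; 1F; 2F)
open import Data.List.Base using (List; []; _∷_; _++_)
open import Data.List.Membership.Propositional using () renaming (_∈_ to _∈ˡ_)
open import Data.List.Membership.Propositional.Properties using (∈-++⁺ˡ; ∈-++⁺ʳ)
open import Data.List.Relation.Unary.Any using (Any)
open import Data.Nat.Base using (ℕ) renaming (_<_ to _<ℕ_)
import Data.Nat.Properties as ℕ
open import Data.Product.Base using (Σ-syntax; ∃; ∃-syntax; _×_; _,_; proj₁; proj₂)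
open import Data.Rational.Base using (ℚ; 0ℚ; 1ℚ; _+_; _-_; -_; _<_)
import Data.Rational.Properties as ℚ
open import Data.Sum.Base using (_⊎_; inj₁; inj₂; [_,_]′)
open import Function.Base using (flip; _∘_; case_of_)
open import Function.Bundles using (_⇔_)
open import Function.Definitions using (Injective)
open import Function.Metric.Structures using (IsGeneralMetric)
open import Level using (0ℓ) renaming (suc to lsuc)
open import Relation.Binary.Core using (Rel)
open import Relation.Binary.Definitions using (Transitive)
import Relation.Binary.Construct.Flip.EqAndOrd as Flip
import Relation.Binary.Construct.StrictToNonStrict as StrictToNonStrict
open import Relation.Binary.Lattice.Bundles using (BoundedLattice)
open import Relation.Binary.Lattice.Structures using (IsHeytingAlgebra)
open import Relation.Binary.PropositionalEquality
  using (_≡_; refl; sym; trans; cong; subst; isEquivalence; resp₂)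
open import Relation.Binary.Structures using (IsPartialOrder; IsStrictPartialOrder)
open import Relation.Nullary using (¬_; yes; no; contradiction)
open import Relation.Unary using (Pred; _⊆_; _≐_; _∩_; _∪_; ∁; ∅; U; ⋃; _⊢_)

------------------------------------------------------------------------
-- Ordered topological spaces

-- A subset is a predicate, so a topology must respect extensional
-- equality of predicates.  Openness of ∅ is the empty union.
record TopologicalSpace : Set₁ where
  field
    Carrier : Set
    IsOpen  : Pred (Pred Carrier 0ℓ) 0ℓ
    resp-≐  : ∀ {P Q} → P ≐ Q → IsOpen P → IsOpen Q
    open-U  : IsOpen U
    open-∩  : ∀ {P Q} → IsOpen P → IsOpen Q → IsOpen (P ∩ Q)
    open-⋃  : ∀ {I : Set} (P : I → Pred Carrier 0ℓ) →
              (∀ i → IsOpen (P i)) → IsOpen (⋃ I P)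

  open-∅ : IsOpen ∅
  open-∅ = resp-≐ ((λ ()) , (λ ())) (open-⋃ {I = Empty} (λ ()) (λ ()))

  IsClopen : Pred (Pred Carrier 0ℓ) 0ℓ
  IsClopen P = IsOpen P × IsOpen (∁ P)

  IsCompact : Set₁
  IsCompact = ∀ {I : Set} (P : I → Pred Carrier 0ℓ) → (∀ i → IsOpen (P i)) →
              (∀ p → ∃[ i ] P i p) →
              ∃[ is ] (∀ p → Any (λ i → P i p) is)

record OrderedSpace : Set₁ where
  infix 4 _≤_
  field
    topology       : TopologicalSpace
  open TopologicalSpace topology public
  field
    _≤_            : Rel Carrier 0ℓ
    isPartialOrder : IsPartialOrder _≡_ _≤_

  ↓_ ↑_ : Pred Carrier 0ℓ → Pred Carrier 0ℓ
  (↓ A) p = ∃[ a ] A a × p ≤ a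
  (↑ A) p = ∃[ a ] A a × a ≤ p

  IsUpset : Pred (Pred Carrier 0ℓ) 0ℓ
  IsUpset A = ↑ A ≐ A

_* : OrderedSpace → OrderedSpace
X * = record
  { topology       = topology
  ; _≤_            = flip _≤_
  ; isPartialOrder = Flip.isPartialOrder isPartialOrder
  } where open OrderedSpace X

record PriestleySpace : Set₁ where
  field
    orderedSpace : OrderedSpace
  open OrderedSpace orderedSpace public
  field
    compact      : IsCompact
    separation   : ∀ {p q} → ¬ p ≤ q →
                   ∃[ V ] IsClopen V × IsUpset V × V p × ¬ V q

-- `induced` says that the topology of Y is the one
-- induced along the function, i.e. that the function is a homeomorphism onto
-- its image.
record Embedding (Y X : OrderedSpace) : Set₁ where
  private
    module Y = OrderedSpace Y
    module X = OrderedSpace X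
  field
    to         : Y.Carrier → X.Carrier
    injective  : Injective _≡_ _≡_ to
    continuous : ∀ {V} → X.IsOpen V → Y.IsOpen (to ⊢ V)
    induced    : ∀ {W} → Y.IsOpen W → ∃[ V ] X.IsOpen V × W ≐ (to ⊢ V)
    order      : ∀ {p q} → p Y.≤ q ⇔ to p X.≤ to q

------------------------------------------------------------------------
-- Real numbers and metrizability

-- Dedekind cuts, given by their lower halves; with excluded middle this is
-- the complete ordered field of reals.
record ℝ : Set₁ where
  field
    lower     : Pred ℚ 0ℓ
    inhabited : ∃[ q ] lower q
    bounded   : ∃[ q ] ¬ lower q
    downward  : ∀ {p q} → p < q → lower q → lower p
    rounded   : ∀ {p} → lower p → ∃[ q ] p < q × lower q

open ℝ

infix 4 _≤ᴿ_ _<ᴿ_ _≃ᴿ_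
infixl 6 _+ᴿ_

_≤ᴿ_ _<ᴿ_ _≃ᴿ_ : Rel ℝ 0ℓ
a ≤ᴿ b = lower a ⊆ lower b
a <ᴿ b = ∃[ q ] ¬ lower a q × lower b q
a ≃ᴿ b = lower a ≐ lower b

0ᴿ : ℝ
0ᴿ = record
  { lower     = _< 0ℚ
  ; inhabited = - 1ℚ , ℚ.negative⁻¹ (- 1ℚ)
  ; bounded   = 0ℚ , ℚ.<-irrefl refl
  ; downward  = ℚ.<-trans
  ; rounded   = ℚ.<-dense
  }

_+ᴿ_ : ℝ → ℝ → ℝ
a +ᴿ b = record
  { lower     = λ r → ∃[ p ] ∃[ q ] lower a p × lower b q × r ≡ p + q
  ; inhabited = _ , _ , _ , proj₂ (inhabited a) , proj₂ (inhabited b) , refl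
  ; bounded   = proj₁ (bounded a) + proj₁ (bounded b) , λ
      (p , q , ap , bq , eq) →
        ℚ.<-irrefl (sym eq) (ℚ.+-mono-< (below a ap (proj₂ (bounded a)))
                                        (below b bq (proj₂ (bounded b))))
  ; downward  = λ { {r} r<s (p , q , ap , bq , refl) →
      r - q , q , downward a (shift r p q r<s) ap , bq , sym (cancel r q) }
  ; rounded   = λ { (p , q , ap , bq , refl) →
      let p′ , p<p′ , ap′ = rounded a ap in
      p′ + q , ℚ.+-monoˡ-< q p<p′ , p′ , q , ap′ , bq , refl }
  }
  where
  below : ∀ c {p q} → lower c p → ¬ lower c q → p < q
  below c {p} {q} cp ¬cq with p ℚ.<? q
  ... | yes p<q = p<q
  ... | no  p≮q with q ℚ.<? p
  ...   | yes q<p = contradiction (downward c q<p cp) ¬cq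
  ...   | no  q≮p = contradiction
                      (subst (lower c) (ℚ.≤-antisym (ℚ.≮⇒≥ q≮p) (ℚ.≮⇒≥ p≮q)) cp) ¬cq

  cancel : ∀ r q → (r - q) + q ≡ r
  cancel r q = trans (ℚ.+-assoc r (- q) q)
                     (trans (cong (r +_) (ℚ.+-inverseˡ q)) (ℚ.+-identityʳ r))

  shift : ∀ r p q → r < p + q → r - q < p
  shift r p q r<p+q = subst (r - q <_)
    (trans (ℚ.+-assoc p q (- q))
           (trans (cong (p +_) (ℚ.+-inverseʳ q)) (ℚ.+-identityʳ p)))
    (ℚ.+-monoˡ-< (- q) r<p+q)

Metrizable : TopologicalSpace → Set₁
Metrizable X = Σ[ d ∈ (Carrier → Carrier → ℝ) ]
    IsGeneralMetric _≡_ _≃ᴿ_ _≤ᴿ_ 0ᴿ _+ᴿ_ d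
  × (∀ V → IsOpen V ⇔ (∀ p → V p → ∃[ ε ] 0ᴿ <ᴿ ε × (λ q → d p q <ᴿ ε) ⊆ V))
  where open TopologicalSpace X

------------------------------------------------------------------------
-- Bi-Heyting algebras and the lattice of clopen upsets

-- The second component is a Heyting algebra structure on the order dual.
IsBiHeyting : ∀ {c ℓ₁ ℓ₂} → BoundedLattice c ℓ₁ ℓ₂ → Set _
IsBiHeyting L =
    (∃ λ _⇨_ → IsHeytingAlgebra _≈_ _≤_ _∨_ _∧_ _⇨_ ⊤ ⊥)
  × (∃ λ _⇦_ → IsHeytingAlgebra _≈_ (flip _≤_) _∧_ _∨_ _⇦_ ⊥ ⊤)
  where open BoundedLattice L

record ClopenUpset (X : PriestleySpace) : Set₁ where
  open PriestleySpace X
  field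
    set      : Pred Carrier 0ℓ
    isClopen : IsClopen set
    isUpset  : IsUpset set

-- Excluded middle is needed for the complement of an intersection to be the
-- union of the complements.
clopenUpsets : ExcludedMiddle 0ℓ → PriestleySpace → BoundedLattice (lsuc 0ℓ) 0ℓ 0ℓ
clopenUpsets em X = record
  { Carrier = ClopenUpset X
  ; _≈_     = λ A B → set A ≐ set B
  ; _≤_     = λ A B → set A ⊆ set B
  ; _∨_     = _∨_
  ; _∧_     = _∧_
  ; ⊤       = record
      { set      = U
      ; isClopen = open-U , resp-≐ ((λ ()) , (λ ¬⊤ → contradiction _ ¬⊤)) open-∅
      ; isUpset  = _ , (λ {p} _ → p , _ , ≤.refl) }
  ; ⊥       = record
      { set      = ∅
      ; isClopen = open-∅ , resp-≐ ((λ _ ()) , _) open-U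
      ; isUpset  = (λ { (_ , () , _) }) , (λ ()) }
  ; isBoundedLattice = record
      { isLattice = record
          { isPartialOrder = record
              { isPreorder = record
                  { isEquivalence = record
                      { refl  = (λ p → p) , (λ p → p)
                      ; sym   = λ (f , g) → g , f
                      ; trans = λ (f , g) (h , k) → h ∘ f , g ∘ k }
                  ; reflexive = proj₁
                  ; trans     = λ f g → g ∘ f }
              ; antisym = _,_ }
          ; supremum = λ _ _ → inj₁ , inj₂ , λ _ f g → [ f , g ]′
          ; infimum  = λ _ _ → proj₁ , proj₂ , λ _ f g p → f p , g p }
      ; maximum = _
      ; minimum = λ _ () }
  }
  where
  open PriestleySpace X
  open ClopenUpset
  module ≤ = IsPartialOrder isPartialOrder

  open-∪ : ∀ {P Q} → IsOpen P → IsOpen Q → IsOpen (P ∪ Q)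
  open-∪ {P} {Q} oP oQ = resp-≐
    ( (λ { (true , p) → inj₁ p ; (false , q) → inj₂ q })
    , [ true ,_ , false ,_ ]′ )
    (open-⋃ (λ { true → P ; false → Q }) (λ { true → oP ; false → oQ }))

  _∨_ _∧_ : ClopenUpset X → ClopenUpset X → ClopenUpset X
  A ∨ B = record
    { set      = set A ∪ set B
    ; isClopen = open-∪ (proj₁ (isClopen A)) (proj₁ (isClopen B))
               , resp-≐ ( (λ (¬a , ¬b) → [ ¬a , ¬b ]′)
                        , (λ ¬ab → ¬ab ∘ inj₁ , ¬ab ∘ inj₂))
                        (open-∩ (proj₂ (isClopen A)) (proj₂ (isClopen B)))
    ; isUpset  = (λ { (p , inj₁ a , le) → inj₁ (proj₁ (isUpset A) (p , a , le))
                    ; (p , inj₂ b , le) → inj₂ (proj₁ (isUpset B) (p , b , le)) })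
               , (λ {p} ab → p , ab , ≤.refl) }
  A ∧ B = record
    { set      = set A ∩ set B
    ; isClopen = open-∩ (proj₁ (isClopen A)) (proj₁ (isClopen B))
               , resp-≐ ( (λ { (inj₁ ¬a) (a , _) → ¬a a ; (inj₂ ¬b) (_ , b) → ¬b b })
                        , (λ {p} ¬ab → case em {set A p} of λ
                            { (yes a) → inj₂ (λ b → ¬ab (a , b))
                            ; (no ¬a) → inj₁ ¬a }))
                        (open-∪ (proj₂ (isClopen A)) (proj₂ (isClopen B)))
    ; isUpset  = (λ (p , (a , b) , le) →
                    proj₁ (isUpset A) (p , a , le) , proj₁ (isUpset B) (p , b , le))
               , (λ {p} ab → p , ab , ≤.refl) }

DualToBiHeyting : ExcludedMiddle 0ℓ → PriestleySpace → Set₁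
DualToBiHeyting em X = IsBiHeyting (clopenUpsets em X)

------------------------------------------------------------------------
-- The spaces Z₁, Z₂, Z₃

-- Points other than x form a countable discrete space.
data Point : Set where
  x y : Point
  z   : ℕ → Point

-- The one-point compactification by x of the discrete space Point ∖ {x}: any
-- set avoiding x is open, and a set containing x is open iff its complement
-- is compact, that is, finite.
Z-topology : TopologicalSpace
Z-topology = record
  { Carrier = Point
  ; IsOpen  = λ V → V x → ∃[ ps ] (∀ p → V p ⊎ p ∈ˡ ps)
  ; resp-≐  = λ (V⊆W , W⊆V) cofin w →
      let ps , f = cofin (W⊆V w) in ps , λ p → [ inj₁ ∘ V⊆W , inj₂ ]′ (f p)
  ; open-U  = λ _ → [] , λ _ → inj₁ _
  ; open-∩  = λ cofin₁ cofin₂ (v , w) →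
      let ps , f = cofin₁ v
          qs , g = cofin₂ w
      in ps ++ qs , λ p → [ (λ a → [ (λ b → inj₁ (a , b))
                                   , inj₂ ∘ ∈-++⁺ʳ ps ]′ (g p))
                          , inj₂ ∘ ∈-++⁺ˡ ]′ (f p)
  ; open-⋃  = λ _ cofin (i , v) →
      let ps , f = cofin i v in ps , λ p → [ (λ a → inj₁ (i , a)) , inj₂ ]′ (f p)
  }

data _<₁_ : Rel Point 0ℓ where
  x<y : x <₁ y
  z<z : ∀ {m n} → m <ℕ n → z n <₁ z m
  x<z : ∀ {n} → x <₁ z n

data _<₂_ : Rel Point 0ℓ where
  x<y : x <₂ y
  x<z : ∀ {n} → x <₂ z n

data _<₃_ : Rel Point 0ℓ where
  x<y : x <₃ y

Z-strict : Fin 3 → Rel Point 0ℓ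
Z-strict 0F = _<₁_
Z-strict 1F = _<₂_
Z-strict 2F = _<₃_

Z-isStrictPartialOrder : ∀ i → IsStrictPartialOrder _≡_ (Z-strict i)
Z-isStrictPartialOrder i = record
  { isEquivalence = isEquivalence
  ; irrefl        = λ { refl → irrefl i }
  ; trans         = <-trans i
  ; <-resp-≈      = resp₂ (Z-strict i)
  }
  where
  irrefl : ∀ i {p} → ¬ Z-strict i p p
  irrefl 0F (z<z n<n) = ℕ.<-irrefl refl n<n
  irrefl 1F ()
  irrefl 2F ()
  <-trans : ∀ i → Transitive (Z-strict i)
  <-trans 0F (z<z m<n) (z<z k<m) = z<z (ℕ.<-trans k<m m<n)
  <-trans 0F x<z       (z<z _)   = x<z
  <-trans 1F x<y ()
  <-trans 1F x<z ()
  <-trans 2F x<y ()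

Z : Fin 3 → OrderedSpace
Z i = record
  { topology       = Z-topology
  ; _≤_            = StrictToNonStrict._≤_ _≡_ (Z-strict i)
  ; isPartialOrder = StrictToNonStrict.isPartialOrder _≡_ (Z-strict i)
                       (Z-isStrictPartialOrder i)
  }

Z₁ Z₂ Z₃ : OrderedSpace
Z₁ = Z 0F
Z₂ = Z 1F
Z₃ = Z 2F

{-# OPTIONS --safe #-}

-- The lattice of clopen upsets is a Heyting algebra iff ↓V is open for every
-- open V, and dually for co-Heyting algebras and ↑V, so it suffices to treat
-- downsets.  If V is open and p₀ ≤ y₀ ∈ V, but ↓V is not a neighbourhood of p₀,
-- then p₀ is adherent to S = ∁ (↓V) ∖ ↑y₀.  By metrizability sequences in S
-- converge to p₀, and together with p₀ and y₀ they are copies of some Zᵢ once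
-- their order is controlled.  No s ∈ S lies below p₀, so terms close to p₀ are
-- not above s.  If p₀ is adherent to S ∖ ↑p₀, a thinned sequence there is an
-- antichain (Z₃).  Otherwise let T = S ∩ ↑p₀: either p₀ is adherent to the set
-- of s ∈ T with p₀ not adherent to T ∩ ↓s, which again gives an antichain (Z₂),
-- or close to p₀ one can descend from every s ∈ T, which gives a chain (Z₁).

module Submission where

open import Defs
open import Axiom.ExcludedMiddle using (ExcludedMiddle)
open import Data.Fin.Base using (Fin)
open import Data.Fin.Patterns using (0F; 1F; 2F)
open import Data.Integer.Base using (+_; +≤+)
open import Data.List.Base using (List; []; _∷_; foldr; map; upTo)
open import Data.List.Membership.Propositional using (_∈_)
open import Data.List.Membership.Propositional.Properties using (∈-map⁺; ∈-upTo⁺)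
open import Data.List.Relation.Unary.All as All using (All; []; _∷_)
open import Data.List.Relation.Unary.Any using (here; there)
open import Data.Maybe.Base using (Maybe; just; nothing)
open import Data.Nat.Base as ℕ using (ℕ; zero; suc; z≤n; s≤s)
open import Data.Nat.Coprimality using (1-coprimeTo)
import Data.Nat.Properties as ℕ
open import Data.Product.Base using (Σ-syntax; ∃; ∃-syntax; _×_; _,_; proj₁; proj₂)
open import Data.Rational.Base as ℚ using (ℚ; 0ℚ; 1ℚ; mkℚ; *≤*)
import Data.Rational.Properties as ℚ
open import Data.Sum.Base using (_⊎_; inj₁; inj₂; [_,_]′)
open import Function.Base using (_∘_)
open import Function.Bundles using (_⇔_; mk⇔; module Equivalence)
open import Function.Metric.Structures using (IsGeneralMetric)
open import Level using (Level; 0ℓ) renaming (suc to lsuc)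
open import Relation.Binary.Core using (Rel)
import Relation.Binary.Construct.Flip.EqAndOrd as Flip
open import Relation.Binary.Definitions using (Transitive; tri<; tri≈; tri>)
open import Relation.Binary.Lattice.Bundles using (BoundedLattice)
open import Relation.Binary.Lattice.Structures using (IsHeytingAlgebra)
open import Relation.Binary.PropositionalEquality
  using (_≡_; _≢_; refl; sym; cong; subst; module ≡-Reasoning)
open import Relation.Binary.Structures using (IsPartialOrder)
open import Relation.Nullary using (¬_; yes; no; contradiction)
open import Relation.Nullary.Decidable using (decidable-stable)
open import Relation.Unary using (Pred; _⊆_; _≐_; _∩_; _∪_; ∁; U; ⋃; ｛_｝; _⊢_; Empty)

private
  variable
    a r : Level

-- Open sets and countable neighbourhood bases.

module _ (T : TopologicalSpace) where
  open TopologicalSpace T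

  open-pointwise : ∀ {V} →
    (∀ {p} → V p → Σ[ W ∈ Pred Carrier 0ℓ ] IsOpen W × W p × W ⊆ V) → IsOpen V
  open-pointwise {V} f = resp-≐
    ( (λ ((_ , v) , w) → proj₂ (proj₂ (proj₂ (f v))) w)
    , (λ v → (_ , v) , proj₁ (proj₂ (proj₂ (f v)))))
    (open-⋃ {I = ∃ V} (λ (_ , v) → proj₁ (f v)) (λ (_ , v) → proj₁ (proj₂ (f v))))

  open-∪ : ∀ {V W} → IsOpen V → IsOpen W → IsOpen (V ∪ W)
  open-∪ oV oW = open-pointwise
    [ (λ v → _ , oV , v , inj₁) , (λ w → _ , oW , w , inj₂) ]′

  -- In place of nestedness, `ball-small` speaks of all large indices, so that any sequence with its
  -- `n`-th term in `ball n` converges to `p`.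
  record NeighbourhoodBase (p : Carrier) : Set₁ where
    field
      ball        : ℕ → Pred Carrier 0ℓ
      ball-open   : ∀ n → IsOpen (ball n)
      ball-centre : ∀ n → ball n p
      ball-small  : ∀ {V} → IsOpen V → V p → ∃[ N ] ∀ {n} → N ℕ.≤ n → ball n ⊆ V

-- Metric balls as a countable neighbourhood base.

fromℚ : ℚ → ℝ
fromℚ q = record
  { lower     = ℚ._< q
  ; inhabited = q ℚ.- 1ℚ , subst (q ℚ.- 1ℚ ℚ.<_) (ℚ.+-identityʳ q)
                             (ℚ.+-monoʳ-< q (ℚ.negative⁻¹ (ℚ.- 1ℚ)))
  ; bounded   = q , ℚ.<-irrefl refl
  ; downward  = ℚ.<-trans
  ; rounded   = ℚ.<-dense
  }

lower<∁lower : ∀ c {p q} → ℝ.lower c p → ¬ ℝ.lower c q → p ℚ.< q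
lower<∁lower c {p} {q} cp ¬cq with ℚ.<-cmp p q
... | tri< p<q _ _    = p<q
... | tri≈ _ refl _   = contradiction cp ¬cq
... | tri> _ _ q<p    = contradiction (ℝ.downward c q<p cp) ¬cq

radius : ℕ → ℚ
radius n = mkℚ (+ 1) n (1-coprimeTo (suc n))

radius-positive : ∀ n → 0ℚ ℚ.< radius n
radius-positive n = ℚ.positive⁻¹ (radius n)

-- The denominator serves as the bound: `mkℚ` stores it minus one, so `q` is (k+1)/(N+1), and n ≥ N
-- gives 1/(n+1) ≤ 1/(N+1) ≤ q.
archimedean : ∀ {q} → 0ℚ ℚ.< q → ∃[ N ] ∀ {n} → N ℕ.≤ n → radius n ℚ.≤ q
archimedean {q} 0<q = go q (ℚ.positive 0<q)
  where
  go : ∀ q → ℚ.Positive q → ∃[ N ] ∀ {n} → N ℕ.≤ n → radius n ℚ.≤ q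
  go (mkℚ (+ suc k) N _) _ =
    N , λ N≤n → *≤* (+≤+ (ℕ.*-mono-≤ (s≤s (z≤n {k})) (s≤s N≤n)))

q+[r-q]≡r : ∀ q r → q ℚ.+ (r ℚ.- q) ≡ r
q+[r-q]≡r q r = begin
  q ℚ.+ (r ℚ.- q)     ≡⟨ ℚ.+-comm q (r ℚ.- q) ⟩
  (r ℚ.- q) ℚ.+ q     ≡⟨ ℚ.+-assoc r (ℚ.- q) q ⟩
  r ℚ.+ (ℚ.- q ℚ.+ q) ≡⟨ cong (r ℚ.+_) (ℚ.+-inverseˡ q) ⟩
  r ℚ.+ 0ℚ            ≡⟨ ℚ.+-identityʳ r ⟩
  r                   ∎
  where open ≡-Reasoning

q<r⇒0<r-q : ∀ {q r} → q ℚ.< r → 0ℚ ℚ.< r ℚ.- q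
q<r⇒0<r-q {q} {r} q<r =
  subst (ℚ._< r ℚ.- q) (ℚ.+-inverseʳ q) (ℚ.+-monoˡ-< (ℚ.- q) q<r)

module _ {T : TopologicalSpace} (metrizable : Metrizable T) where
  open TopologicalSpace T
  private
    d = proj₁ metrizable
    module d = IsGeneralMetric (proj₁ (proj₂ metrizable))
    module Open V = Equivalence (proj₂ (proj₂ metrizable) V)

  ballᵈ : Carrier → ℚ → Pred Carrier 0ℓ
  ballᵈ p r q = d p q <ᴿ fromℚ r

  -- Strict inequality comes with a rational `s` such that d p q ≤ s < r. The ball of radius r - s
  -- about `q` stays inside: d q q′ ≤ t < r - s gives d p q′ ≤ s + t < r.
  ballᵈ-open : ∀ p r → IsOpen (ballᵈ p r)
  ballᵈ-open p r = Open.from (ballᵈ p r) λ q (s , d≮s , s<r) →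
      fromℚ (r ℚ.- s)
    , (0ℚ , ℚ.<-irrefl refl , q<r⇒0<r-q s<r)
    , λ {q′} (t , d≮t , t<r-s) →
          s ℚ.+ t
        , (λ s+t<d → let a , b , a<d , b<d , eq = d.triangle p q q′ s+t<d in
            ℚ.<-irrefl (sym eq) (ℚ.+-mono-< (lower<∁lower (d p q) a<d d≮s)
                                            (lower<∁lower (d q q′) b<d d≮t)))
        , subst (s ℚ.+ t ℚ.<_) (q+[r-q]≡r s r) (ℚ.+-monoʳ-< s t<r-s)

  metrizable⇒neighbourhoodBase : ∀ p → NeighbourhoodBase T p
  metrizable⇒neighbourhoodBase p = record
    { ball        = ballᵈ p ∘ radius
    ; ball-open   = ballᵈ-open p ∘ radius
    ; ball-centre = λ n →
        0ℚ , (λ 0<d → ℚ.<-irrefl refl (proj₁ (d.≈⇒0 refl) 0<d)) , radius-positive n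
    ; ball-small  = λ {V} oV v →
        let ε , (s , s≮0 , s<ε) , B⊆V = Open.to V oV p v
            -- `s` is only known to be nonnegative; roundedness of `ε` yields a larger, hence
            -- positive, rational to compare with the radii.
            t , s<t , t<ε = ℝ.rounded ε s<ε
            N , small = archimedean (ℚ.≤-<-trans (ℚ.≮⇒≥ s≮0) s<t)
        in N , λ N≤n (u , d≮u , u<radius) →
             B⊆V (u , d≮u , ℝ.downward ε (ℚ.<-≤-trans u<radius (small N≤n)) t<ε)
    }

-- Dependent choice with a condition varying with the index. The seed `s₀` only starts the recursion
-- and is not a term, as it may fail `Q 0`.
dependentChain : {S : Set a} {_∼_ : Rel S r} {Q : ℕ → Pred S 0ℓ} → Transitive _∼_ → S →
  (∀ n s → ∃[ s′ ] Q n s′ × s ∼ s′) →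
  Σ[ f ∈ (ℕ → S) ] (∀ n → Q n (f n)) × (∀ {m n} → m ℕ.< n → f m ∼ f n)
dependentChain {S = S} {_∼_} {Q} ∼-trans s₀ step = f , holds , chain
  where
  f : ℕ → S
  f zero    = proj₁ (step zero s₀)
  f (suc n) = proj₁ (step (suc n) (f n))

  holds : ∀ n → Q n (f n)
  holds zero    = proj₁ (proj₂ (step zero s₀))
  holds (suc n) = proj₁ (proj₂ (step (suc n) (f n)))

  next : ∀ n → f n ∼ f (suc n)
  next n = proj₂ (proj₂ (step (suc n) (f n)))

  chain′ : ∀ {m n} → m ℕ.<′ n → f m ∼ f n
  chain′ ℕ.<′-base        = next _
  chain′ (ℕ.<′-step m<n) = ∼-trans (chain′ m<n) (next _)

  chain : ∀ {m n} → m ℕ.< n → f m ∼ f n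
  chain m<n = chain′ (ℕ.<⇒<′ m<n)

-- Forbidden configurations and openness of downsets.

x<ᵢy : ∀ i → Z-strict i x y
x<ᵢy 0F = x<y
x<ᵢy 1F = x<y
x<ᵢy 2F = x<y

OpenDownsets : OrderedSpace → Set₁
OpenDownsets X = ∀ {V} → IsOpen V → IsOpen (↓ V)
  where open OrderedSpace X

-- Alternative (a) of the theorem; at `X *` it becomes (b) once the order reversal is moved from `X`
-- to `Z i`.
ForbiddenConfiguration : OrderedSpace → Set₁
ForbiddenConfiguration X =
  Σ[ i ∈ Fin 3 ] Σ[ e ∈ Embedding (Z i) X ]
    let open Embedding e in
    Σ[ V ∈ Pred Carrier 0ℓ ]
      IsOpen V × V (to y) × (to ⊢ (↓ V)) ≐ (｛ x ｝ ∪ ｛ y ｝)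
  where open OrderedSpace X

-- The trace {x, y} of ↓V on Zᵢ has infinite complement, hence is no
-- neighbourhood of x.
forbidden⇒¬openDownsets : ∀ {X} → ForbiddenConfiguration X → ¬ OpenDownsets X
forbidden⇒¬openDownsets {X} (i , e , V , oV , Vy , ⊆xy , xy⊆) open↓ =
  let ps , cofinite = continuous (open↓ oV) (xy⊆ (inj₁ refl)) in
  missing ps λ n →
    [ (λ zn → [ (λ ()) , (λ ()) ]′ (⊆xy zn)) , (λ z∈ → z∈) ]′ (cofinite (z n))
  where
  open Embedding e
  bound : List Point → ℕ
  bound []         = 0
  bound (z n ∷ ps) = suc n ℕ.⊔ bound ps
  bound (_   ∷ ps) = bound ps

  ∈⇒<bound : ∀ {n} ps → z n ∈ ps → n ℕ.< bound ps
  ∈⇒<bound (z _ ∷ ps) (here refl) = ℕ.m≤m⊔n _ (bound ps)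
  ∈⇒<bound (x ∷ ps)   (there z∈)  = ∈⇒<bound ps z∈
  ∈⇒<bound (y ∷ ps)   (there z∈)  = ∈⇒<bound ps z∈
  ∈⇒<bound (z m ∷ ps) (there z∈)  = ℕ.≤-trans (∈⇒<bound ps z∈) (ℕ.m≤n⊔m (suc m) _)

  missing : ∀ ps → ¬ (∀ n → z n ∈ ps)
  missing ps all∈ = ℕ.<-irrefl refl (∈⇒<bound ps (all∈ (bound ps)))

module _ (em : ∀ ℓ → ExcludedMiddle ℓ) where

  ¬¬-elim : {A : Set a} → ¬ ¬ A → A
  ¬¬-elim = decidable-stable (em _)

  dual : PriestleySpace → PriestleySpace
  dual X = record
    { orderedSpace = orderedSpace *
    ; compact      = compact
    ; separation   = λ p≰q →
        let V , (oV , o∁V) , (↑V⊆V , _) , q∈V , p∉V = separation p≰q in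
          ∁ V
        , (o∁V , resp-≐ ((λ v ¬v → ¬v v) , ¬¬-elim) oV)
        , ((λ (_ , ¬v , p≤a) v → ¬v (↑V⊆V (_ , v , p≤a))) , λ ¬v → _ , ¬v , ≤.refl)
        , p∉V
        , λ ¬v → ¬v q∈V
    }
    where
    open PriestleySpace X
    module ≤ = IsPartialOrder isPartialOrder

  -- Compactness arguments and Heyting implications.

  module _ {X : PriestleySpace} where
    open PriestleySpace X
    open ClopenUpset
    private
      module ≤ = IsPartialOrder isPartialOrder

    complement : ClopenUpset (dual X) → ClopenUpset X
    complement A = record
      { set      = ∁ (set A)
      ; isClopen = proj₂ (isClopen A)
                 , resp-≐ ((λ v ¬v → ¬v v) , ¬¬-elim) (proj₁ (isClopen A))
      ; isUpset  = (λ (_ , ¬v , p≤a) v → ¬v (proj₁ (isUpset A) (_ , v , p≤a)))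
                 , λ ¬v → _ , ¬v , ≤.refl
      }

    private
      module Lattice = BoundedLattice (clopenUpsets (em 0ℓ) X)
    open Lattice using (_∧_; _∨_; ⊤; ⊥)

    ⋀ ⋁ : {I : Set} → (I → ClopenUpset X) → List I → ClopenUpset X
    ⋀ A = foldr (λ i → A i ∧_) ⊤
    ⋁ A = foldr (λ i → A i ∨_) ⊥

    module _ {I : Set} {A : I → ClopenUpset X} {p : Carrier} where

      ⋀-intro : (∀ i → set (A i) p) → ∀ is → set (⋀ A is) p
      ⋀-intro f []       = _
      ⋀-intro f (i ∷ is) = f i , ⋀-intro f is

      ⋀-elim : ∀ {is} → set (⋀ A is) p → All (λ i → set (A i) p) is
      ⋀-elim {[]}    _        = []
      ⋀-elim {_ ∷ _} (v , vs) = v ∷ ⋀-elim vs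

      ∉-⋁ : (∀ i → ¬ set (A i) p) → ∀ is → ¬ set (⋁ A is) p
      ∉-⋁ f (i ∷ is) = [ f i , ∉-⋁ f is ]′

      ∉-⋁-elim : ∀ {is} → ¬ set (⋁ A is) p → All (λ i → ¬ set (A i) p) is
      ∉-⋁-elim {[]}    _  = []
      ∉-⋁-elim {_ ∷ _} ¬v = (¬v ∘ inj₁) ∷ ∉-⋁-elim (¬v ∘ inj₂)

    upward : (A : ClopenUpset X) → ∀ {p q} → p ≤ q → set A p → set A q
    upward A p≤q v = proj₁ (isUpset A) (_ , v , p≤q)

    separator : ∀ {p q} → ¬ p ≤ q → Σ[ A ∈ ClopenUpset X ] set A p × ¬ set A q
    separator p≰q = let V , clopen , upset , v , ¬v = separation p≰q in
      record { set = V ; isClopen = clopen ; isUpset = upset } , v , ¬v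

    -- Each point of `K` is missed by some clopen upset containing `p`. The complements of these
    -- upsets, together with `∁ K` (the index `nothing`), cover the space; the meet over a finite
    -- subcover is as desired.
    separator-closed : ∀ {K} → IsOpen (∁ K) → ∀ {p} → ¬ (↓ K) p →
      Σ[ A ∈ ClopenUpset X ] set A p × Empty (set A ∩ K)
    separator-closed {K} o∁K {p} p∉↓K =
        ⋀ A is
      , ⋀-intro (λ { nothing → _ ; (just (_ , k)) → proj₁ (proj₂ (sep k)) }) is
      , λ q (v , k) → All.lookupWith
          (λ { {nothing} _ ¬k → ¬k k ; {just _} Aq ¬Aq → ¬Aq Aq }) (⋀-elim v) (covers q)
      where
      sep : ∀ {q} → K q → Σ[ A ∈ ClopenUpset X ] set A p × ¬ set A q
      sep k = separator (λ p≤q → p∉↓K (_ , k , p≤q))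

      A : Maybe (∃ K) → ClopenUpset X
      A nothing        = ⊤
      A (just (_ , k)) = proj₁ (sep k)

      cover : Maybe (∃ K) → Pred Carrier 0ℓ
      cover nothing  = ∁ K
      cover (just k) = ∁ (set (A (just k)))

      subcover = compact cover
        (λ { nothing → o∁K ; (just k) → proj₂ (isClopen (A (just k))) })
        covered
        where
        covered : ∀ q → ∃[ i ] cover i q
        covered q with em _ {K q}
        ... | yes k = just (q , k) , proj₂ (proj₂ (sep k))
        ... | no ¬k = nothing , ¬k
      is     = proj₁ subcover
      covers = proj₂ subcover

    ↓-closed : ∀ {K} → IsOpen (∁ K) → IsOpen (∁ (↓ K))
    ↓-closed o∁K = open-pointwise topology λ p∉↓K →
      let A , v , disjoint = separator-closed o∁K p∉↓K in
        set A , proj₁ (isClopen A) , v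
      , λ v′ (k , k∈K , q≤k) → disjoint k (upward A q≤k v′ , k∈K)

    _∖_ : ClopenUpset X → ClopenUpset X → Pred Carrier 0ℓ
    A ∖ B = set A ∩ ∁ (set B)

    ∖-open : ∀ A B → IsOpen (A ∖ B)
    ∖-open A B = open-∩ (proj₁ (isClopen A)) (proj₂ (isClopen B))

    ∖-closed : ∀ A B → IsOpen (∁ (A ∖ B))
    ∖-closed A B = resp-≐
      ( [ (λ ¬v (v , _) → ¬v v) , (λ w (_ , ¬w) → ¬w w) ]′
      , λ ¬vw → ¬¬-elim λ ¬∪ → ¬∪ (inj₁ λ v → ¬vw (v , ¬∪ ∘ inj₂)))
      (open-∪ topology (proj₂ (isClopen A)) (proj₁ (isClopen B)))

    -- A point outside `V` differs from `p`, so by antisymmetry one of the two is not below the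
    -- other, and separation gives a difference of clopen upsets containing `p` but not that point.
    -- Compactness leaves finitely many of these to intersect.
    ∖-basis : ∀ {V} → IsOpen V → ∀ {p} → V p →
      Σ[ A ∈ ClopenUpset X ] Σ[ B ∈ ClopenUpset X ] (A ∖ B) p × (A ∖ B) ⊆ V
    ∖-basis {V} oV {p} p∈V =
        ⋀ A is , ⋁ B is
      , (⋀-intro (proj₁ ∘ p∈A∖B) is , ∉-⋁ (proj₂ ∘ p∈A∖B) is)
      , λ {q} (a , ¬b) → All.lookupWith
          (λ { {nothing} _ v → v
             ; {just _} (a , ¬b) → [ (λ ¬a → contradiction a ¬a) , (λ b → contradiction b ¬b) ]′ })
          (All.zip (⋀-elim a , ∉-⋁-elim ¬b)) (covers q)
      where
      sep : ∀ {q} → ¬ V q →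
        Σ[ A ∈ ClopenUpset X ] Σ[ B ∈ ClopenUpset X ] (A ∖ B) p × ¬ (A ∖ B) q
      sep {q} ¬v with em _ {p ≤ q}
      ... | no p≰q  = let A , v , ¬w = separator p≰q in A , ⊥ , (v , λ ()) , ¬w ∘ proj₁
      ... | yes p≤q =
        let B , w , ¬w = separator (λ q≤p → ¬v (subst V (≤.antisym p≤q q≤p) p∈V)) in
        ⊤ , B , (_ , ¬w) , λ (_ , ¬b) → ¬b w

      A B : Maybe (∃ (∁ V)) → ClopenUpset X
      A nothing         = ⊤
      A (just (_ , ¬v)) = proj₁ (sep ¬v)
      B nothing         = ⊥
      B (just (_ , ¬v)) = proj₁ (proj₂ (sep ¬v))

      p∈A∖B : ∀ i → (A i ∖ B i) p
      p∈A∖B nothing         = _ , λ ()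
      p∈A∖B (just (_ , ¬v)) = proj₁ (proj₂ (proj₂ (sep ¬v)))

      cover : Maybe (∃ (∁ V)) → Pred Carrier 0ℓ
      cover nothing  = V
      cover (just i) = ∁ (set (A (just i))) ∪ set (B (just i))

      subcover = compact cover
        (λ { nothing → oV ; (just i) → open-∪ topology (proj₂ (isClopen (A (just i))))
                                                       (proj₁ (isClopen (B (just i)))) })
        covered
        where
        covered : ∀ q → ∃[ i ] cover i q
        covered q with em _ {V q}
        ... | yes v = nothing , v
        ... | no ¬v = just (q , ¬v) , ¬¬-elim λ ¬∪ →
          proj₂ (proj₂ (proj₂ (sep ¬v)))
                (¬¬-elim (¬∪ ∘ inj₁) , ¬∪ ∘ inj₂)
      is     = proj₁ subcover
      covers = proj₂ subcover

    -- The complement of `A ⇨ B` is the downset of the difference of `A` and `B`: modus ponens gives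
    -- one inclusion, and a clopen upset `W` missing the difference satisfies W ∧ A ≤ B, hence W ≤ A
    -- ⇨ B.
    heyting⇒openDownsets : ∀ {_⇨_} →
      IsHeytingAlgebra Lattice._≈_ Lattice._≤_ _∨_ _∧_ _⇨_ ⊤ ⊥ → OpenDownsets orderedSpace
    heyting⇒openDownsets {_⇨_} isHeyting oV = open-pointwise topology λ (a , Va , p≤a) →
      let A , B , (a∈A , a∉B) , A∖B⊆V = ∖-basis oV Va in
        ∁ (set (A ⇨ B))
      , proj₂ (isClopen (A ⇨ B))
      , (λ v → a∉B (transpose-∧ {w = A ⇨ B} {A} {B} (λ w → w) (upward (A ⇨ B) p≤a v , a∈A)))
      , λ q∉ → ¬¬-elim λ q∉↓V →
          let W , q∈W , disjoint = separator-closed (∖-closed A B)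
                λ (c , c∈A∖B , q≤c) → q∉↓V (c , A∖B⊆V c∈A∖B , q≤c)
          in q∉ (transpose-⇨ {w = W} {A} {B}
                  (λ (w , a) → ¬¬-elim λ ¬b → disjoint _ (w , a , ¬b)) q∈W)
      where open IsHeytingAlgebra isHeyting

    openDownsets⇒heyting : OpenDownsets orderedSpace →
      ∃ λ _⇨_ → IsHeytingAlgebra Lattice._≈_ Lattice._≤_ _∨_ _∧_ _⇨_ ⊤ ⊥
    openDownsets⇒heyting open↓ = _⇨_ , record
      { isBoundedLattice = Lattice.isBoundedLattice
      ; exponential      = λ W A B →
            (λ WA⊆B w (a , (a∈A , a∉B) , q≤a) → a∉B (WA⊆B (upward W q≤a w , a∈A)))
          , (λ W⊆A⇨B (w , a) → ¬¬-elim λ ¬b → W⊆A⇨B w (_ , (a , ¬b) , ≤.refl))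
      }
      where
      _⇨_ : ClopenUpset X → ClopenUpset X → ClopenUpset X
      A ⇨ B = record
        { set      = ∁ (↓ (A ∖ B))
        -- The downset is closed by compactness; its openness is the hypothesis.
        ; isClopen = ↓-closed (∖-closed A B)
                   , resp-≐ ((λ v ¬v → ¬v v) , ¬¬-elim) (open↓ (∖-open A B))
        ; isUpset  = (λ (_ , p∉ , p≤q) (a , v , q≤a) → p∉ (a , v , ≤.trans p≤q q≤a))
                   , λ p∉ → _ , p∉ , ≤.refl
        }

    ≰ʳ-open : ∀ p → IsOpen (λ q → ¬ p ≤ q)
    ≰ʳ-open p = open-pointwise topology λ p≰q → let A , p∈A , q∉A = separator p≰q in
      ∁ (set A) , proj₂ (isClopen A) , q∉A , λ r∉A p≤r → r∉A (upward A p≤r p∈A)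

    ≰ˡ-open : ∀ p → IsOpen (λ q → ¬ q ≤ p)
    ≰ˡ-open p = open-pointwise topology λ q≰p → let A , q∈A , p∉A = separator q≰p in
      set A , proj₁ (isClopen A) , q∈A , λ r∈A r≤p → p∉A (upward A r≤p r∈A)

    separating-clopen : ∀ {p q} → p ≢ q → Σ[ C ∈ Pred Carrier 0ℓ ] IsClopen C × C p × ¬ C q
    separating-clopen {p} {q} p≢q with em _ {p ≤ q}
    ... | no p≰q  = let A , p∈A , q∉A = separator p≰q in set A , isClopen A , p∈A , q∉A
    ... | yes p≤q = let A , q∈A , p∉A = separator (p≢q ∘ ≤.antisym p≤q) in
        ∁ (set A)
      , (proj₂ (isClopen A) , resp-≐ ((λ v ¬v → ¬v v) , ¬¬-elim) (proj₁ (isClopen A)))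
      , p∉A , λ q∉A → q∉A q∈A

    ≢-open : ∀ p → IsOpen (λ q → q ≢ p)
    ≢-open p = open-pointwise topology λ q≢p →
      let C , clopen , q∈C , p∉C = separating-clopen q≢p in
      C , proj₁ clopen , q∈C , λ r∈C r≡p → p∉C (subst C r≡p r∈C)

  -- Co-Heyting implications.

  module _ {X : PriestleySpace} where
    open PriestleySpace X
    open ClopenUpset
    private
      module ≤ = IsPartialOrder isPartialOrder
      module Lattice = BoundedLattice (clopenUpsets (em 0ℓ) X)
    open Lattice using (_∧_; _∨_; ⊤; ⊥)

    -- Clopen upsets of `dual X` are complements of those of `X`, so the Heyting case does not apply
    -- verbatim but is mirrored: `B ⇦ A`, the least `W` with A ≤ W ∨ B, is the upset of the
    -- difference of `A` and `B`.
    coheyting⇒openUpsets : ∀ {_⇦_} →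
      IsHeytingAlgebra Lattice._≈_ (λ A B → Lattice._≤_ B A) _∧_ _∨_ _⇦_ ⊥ ⊤ →
      OpenDownsets (orderedSpace *)
    coheyting⇒openUpsets {_⇦_} isHeyting oV = open-pointwise topology λ (a , Va , a≤p) →
      let A , B , (a∈A , a∉B) , A∖B⊆V = ∖-basis {X} oV Va in
        set (B ⇦ A)
      , proj₁ (isClopen (B ⇦ A))
      , [ upward (B ⇦ A) a≤p , (λ a∈B → contradiction a∈B a∉B) ]′
          (transpose-∧ {w = B ⇦ A} {B} {A} (λ w → w) a∈A)
      , λ {q} q∈ → ¬¬-elim λ q∉↑V →
          -- `W` is a clopen downset of `X` missing the difference. Its complement joined with `B`
          -- contains `A`, so minimality puts `B ⇦ A` inside that complement, to which `q` does not
          -- belong.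
          let W , q∈W , disjoint = separator-closed {dual X} (∖-closed {X} A B)
                λ (c , c∈A∖B , c≤q) → q∉↑V (c , A∖B⊆V c∈A∖B , c≤q)
          in transpose-⇨ {w = complement {X} W} {B} {A}
               (λ a → ¬¬-elim λ ¬∪ →
                  ¬∪ (inj₁ λ w → disjoint _ (w , a , ¬∪ ∘ inj₂)))
               q∈ q∈W
      where open IsHeytingAlgebra isHeyting

    openUpsets⇒coheyting : OpenDownsets (orderedSpace *) →
      ∃ λ _⇦_ → IsHeytingAlgebra Lattice._≈_ (λ A B → Lattice._≤_ B A) _∧_ _∨_ _⇦_ ⊥ ⊤
    openUpsets⇒coheyting open↑ = _⇦_ , record
      { isBoundedLattice = record
          { isLattice = record
              { isPartialOrder = Flip.isPartialOrder Lattice.isPartialOrder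
              ; supremum       = Lattice.infimum
              ; infimum        = Lattice.supremum
              }
          ; maximum = Lattice.minimum
          ; minimum = Lattice.maximum
          }
      ; exponential = λ W B A →
            (λ A⊆W∪B (a , (a∈A , a∉B) , a≤q) →
               [ upward W a≤q , (λ a∈B → contradiction a∈B a∉B) ]′ (A⊆W∪B a∈A))
          , λ ⊆W a → ¬¬-elim λ ¬∪ → ¬∪ (inj₁ (⊆W (_ , (a , ¬∪ ∘ inj₂) , ≤.refl)))
      }
      where
      _⇦_ : ClopenUpset X → ClopenUpset X → ClopenUpset X
      B ⇦ A = record
        { set      = ↑ (A ∖ B)
        ; isClopen = open↑ (∖-open A B) , ↓-closed {dual X} (∖-closed A B)
        ; isUpset  = (λ (_ , (a , v , a≤p) , p≤q) → a , v , ≤.trans a≤p p≤q)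
                   , λ p∈ → _ , p∈ , ≤.refl
        }

  -- Copies of `Z i` from convergent sequences.

  module _ {X : PriestleySpace} where
    open PriestleySpace X
    private
      module ≤ = IsPartialOrder isPartialOrder

    module _ {p₀ : Carrier} (base : NeighbourhoodBase topology p₀) where
      open NeighbourhoodBase base

      module _ {y₀ : Carrier} {V : Pred Carrier 0ℓ} (oV : IsOpen V) (y₀∈V : V y₀)
               (p₀≤y₀ : p₀ ≤ y₀) (y₀≰p₀ : ¬ y₀ ≤ p₀)
               {t : ℕ → Carrier} (t∈ball : ∀ n → ball n (t n))
               (t∉↓V : ∀ n → ¬ (↓ V) (t n)) (y₀≰t : ∀ n → ¬ y₀ ≤ t n)
               (i : Fin 3)
               (p₀≤t : ∀ n → p₀ ≤ t n ⇔ Z-strict i x (z n))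
               (t≤t : ∀ m n → t m ≤ t n ⇔ OrderedSpace._≤_ (Z i) (z m) (z n))
               where
        private
          module Zᵢ = OrderedSpace (Z i)

        point : Point → Carrier
        point x     = p₀
        point y     = y₀
        point (z n) = t n

        point-mono : ∀ {p q} → p Zᵢ.≤ q → point p ≤ point q
        point-mono (inj₂ refl) = ≤.refl
        point-mono (inj₁ p<q)  = strict i p≤t≤ p<q
          where
          p≤t≤ : (∀ {n} → Z-strict i x (z n) → p₀ ≤ t n) ×
                 (∀ {m n} → Z-strict i (z m) (z n) → t m ≤ t n)
          p≤t≤ = Equivalence.from (p₀≤t _) , Equivalence.from (t≤t _ _) ∘ inj₁

          strict : ∀ j → (∀ {n} → Z-strict j x (z n) → p₀ ≤ t n) ×
                         (∀ {m n} → Z-strict j (z m) (z n) → t m ≤ t n) →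
                   ∀ {p q} → Z-strict j p q → point p ≤ point q
          strict 0F _       x<y         = p₀≤y₀
          strict 0F (f , _) x<z         = f x<z
          strict 0F (_ , g) (z<z n<m)   = g (z<z n<m)
          strict 1F _       x<y         = p₀≤y₀
          strict 1F (f , _) x<z         = f x<z
          strict 2F _       x<y         = p₀≤y₀

        -- Only comparisons within the sequence and from `p₀` to it depend on `i`. A term below `p₀`
        -- or `y₀` would lie in `↓ V`, and `y₀` is below neither `p₀` nor any term.
        point-reflects : ∀ p q → point p ≤ point q → p Zᵢ.≤ q
        point-reflects x     x     _    = inj₂ refl
        point-reflects x     y     _    = inj₁ (x<ᵢy i)
        point-reflects x     (z n) x≤t  = inj₁ (Equivalence.to (p₀≤t n) x≤t)
        point-reflects y     x     y≤x  = contradiction y≤x y₀≰p₀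
        point-reflects y     y     _    = inj₂ refl
        point-reflects y     (z n) y≤t  = contradiction y≤t (y₀≰t n)
        point-reflects (z n) x     t≤x  = contradiction (y₀ , y₀∈V , ≤.trans t≤x p₀≤y₀) (t∉↓V n)
        point-reflects (z n) y     t≤y  = contradiction (y₀ , y₀∈V , t≤y) (t∉↓V n)
        point-reflects (z m) (z n) tm≤tn = Equivalence.to (t≤t m n) tm≤tn

        point-injective : ∀ {p q} → point p ≡ point q → p ≡ q
        point-injective eq = IsPartialOrder.antisym Zᵢ.isPartialOrder
          (point-reflects _ _ (≤.reflexive eq)) (point-reflects _ _ (≤.reflexive (sym eq)))

        point-continuous : ∀ {W} → IsOpen W → Zᵢ.IsOpen (point ⊢ W)
        point-continuous {W} oW w = y ∷ map z (upTo N) , cofinite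
          where
          N     = proj₁ (ball-small oW w)
          small = proj₂ (ball-small oW w)

          cofinite : ∀ p → W (point p) ⊎ p ∈ y ∷ map z (upTo N)
          cofinite x = inj₁ w
          cofinite y = inj₂ (here refl)
          cofinite (z n) with n ℕ.<? N
          ... | yes n<N = inj₂ (there (∈-map⁺ z (∈-upTo⁺ n<N)))
          ... | no  n≮N = inj₁ (small (ℕ.≮⇒≥ n≮N) (t∈ball n))

        -- Only the listed points might have to be cut out. For such a `p` the condition
        -- `W p ⊎ q ≢ point p` removes `point p` exactly when `p` is outside `W`; either way it is
        -- open in `q`, points being closed.
        point-induced-∋x : ∀ {W} → Zᵢ.IsOpen W → W x →
          Σ[ V ∈ Pred Carrier 0ℓ ] IsOpen V × W ≐ (point ⊢ V)
        point-induced-∋x {W} oW w = let ps , cofinite = oW w in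
            (λ q → All (λ p → W p ⊎ q ≢ point p) ps)
          , open-All ps
          , (λ {p} p∈W → All.tabulate λ {r} _ → ∈W⊎≢ r p∈W)
          , λ {p} all → [ (λ p∈W → p∈W)
                        , (λ p∈ps → [ (λ p∈W → p∈W) , contradiction refl ]′
                                      (All.lookup all p∈ps)) ]′ (cofinite p)
          where
          ∈W⊎≢ : ∀ {p} r → W p → W r ⊎ point p ≢ point r
          ∈W⊎≢ r p∈W with em _ {W r}
          ... | yes r∈W = inj₁ r∈W
          ... | no  r∉W = inj₂ λ eq → r∉W (subst W (point-injective eq) p∈W)

          open-All : ∀ ps → IsOpen (λ q → All (λ p → W p ⊎ q ≢ point p) ps)
          open-All []       = resp-≐ ((λ _ → []) , _) open-U
          open-All (p ∷ ps) = resp-≐ ((λ (v , vs) → v ∷ vs) , λ { (v ∷ vs) → v , vs })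
            (open-∩ (open-∪ topology const-open (≢-open {X} (point p))) (open-All ps))
            where
            const-open : IsOpen (λ _ → W p)
            const-open = open-pointwise topology λ p∈W → U , open-U , _ , λ _ → p∈W

        -- A point p ≠ x has a clopen neighbourhood C missing x, so p can be
        -- carved out of the neighbourhood W ∪ point⁻¹(∁ C) of x.
        point-induced : ∀ {W} → Zᵢ.IsOpen W →
          Σ[ V ∈ Pred Carrier 0ℓ ] IsOpen V × W ≐ (point ⊢ V)
        point-induced {W} oW with em _ {W x}
        ... | yes x∈W = point-induced-∋x oW x∈W
        ... | no  x∉W =
            ⋃ (∃ W) (λ (_ , w) → proj₁ (local w))
          , open-⋃ _ (λ (_ , w) → proj₁ (proj₂ (local w)))
          , (λ w → (_ , w) , proj₁ (proj₂ (proj₂ (local w))))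
          , λ ((_ , w) , v) → proj₂ (proj₂ (proj₂ (local w))) v
          where
          local : ∀ {p} → W p → Σ[ V ∈ Pred Carrier 0ℓ ]
                    IsOpen V × V (point p) × (point ⊢ V) ⊆ W
          local {p} w =
            let C , (oC , o∁C) , p∈C , x∉C = separating-clopen {X} {point p} {point x}
                  (λ eq → x∉W (subst W (point-injective eq) w))
                oW∪ = open-∪ Z-topology {W} {point ⊢ ∁ C} oW (point-continuous o∁C)
                O , oO , ⊆O , O⊆ = point-induced-∋x oW∪ (inj₂ x∉C)
            in C ∩ O , open-∩ oC oO , (p∈C , ⊆O (inj₁ w))
             , λ (c , o) → [ (λ w → w) , contradiction c ]′ (O⊆ o)

        sequence⇒forbidden : ForbiddenConfiguration orderedSpace
        sequence⇒forbidden = i , e , V , oV , y₀∈V , (λ {p} → trace p) , trace⁻¹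
          where
          e : Embedding (Z i) orderedSpace
          e = record
            { to         = point
            ; injective  = point-injective
            ; continuous = point-continuous
            ; induced    = point-induced
            ; order      = mk⇔ point-mono (point-reflects _ _)
            }

          trace : ∀ p → (↓ V) (point p) → (｛ x ｝ ∪ ｛ y ｝) p
          trace x     _ = inj₁ refl
          trace y     _ = inj₂ refl
          trace (z n) v = contradiction v (t∉↓V n)

          trace⁻¹ : ∀ {p} → (｛ x ｝ ∪ ｛ y ｝) p → (↓ V) (point p)
          trace⁻¹ (inj₁ refl) = y₀ , y₀∈V , p₀≤y₀
          trace⁻¹ (inj₂ refl) = y₀ , y₀∈V , ≤.refl

      -- Adherence and the choice of convergent sequences.

      Adherent : Pred (Pred Carrier 0ℓ) 0ℓ
      Adherent S = ∀ n → ∃ (ball n ∩ S)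

      adherent? : ∀ S → Adherent S ⊎ ∃[ n ] Empty (ball n ∩ S)
      adherent? S with em _ {∃[ n ] Empty (ball n ∩ S)}
      ... | yes isolated = inj₂ isolated
      ... | no ¬isolated = inj₁ λ n → ¬¬-elim λ ¬∃ → ¬isolated (n , λ p p∈ → ¬∃ (p , p∈))

      adherent-⊆ : ∀ {S T} → S ⊆ T → Adherent S → Adherent T
      adherent-⊆ S⊆T adh n = let p , p∈ball , p∈S = adh n in p , p∈ball , S⊆T p∈S

      adherent-∩ : ∀ {S W} → Adherent S → IsOpen W → W p₀ → Adherent (W ∩ S)
      adherent-∩ adh oW w n =
        let N , small       = ball-small (open-∩ (ball-open n) oW) (ball-centre n , w)
            p , p∈ball , p∈S = adh N
            p∈ball′ , p∈W    = small ℕ.≤-refl p∈ball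
        in p , p∈ball′ , p∈W , p∈S

      module _ {T : Pred Carrier 0ℓ} {_∼_ : Rel Carrier 0ℓ} (adh : Adherent T) where

        -- Each term is chosen by its relation to its predecessor alone. This serves the descending
        -- chain of `Z₁`; incomparability is not transitive and goes through `convergent-sequence`.
        convergent-chain : Transitive _∼_ → (∀ {s} → T s → Adherent (T ∩ (s ∼_))) →
          Σ[ t ∈ (ℕ → Carrier) ]
            (∀ n → ball n (t n)) × (∀ n → T (t n)) × (∀ {m n} → m ℕ.< n → t m ∼ t n)
        convergent-chain ∼-trans recurrent =
          let f , f∈ball , chain = dependentChain
                {S = ∃ T} {λ (s , _) (t , _) → s ∼ t} {λ n (t , _) → ball n t} ∼-trans
                (let p , _ , p∈T = adh 0 in p , p∈T)
                (λ n (s , s∈T) → let t , t∈ball , t∈T , s∼t = recurrent s∈T n in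
                   (t , t∈T) , t∈ball , s∼t)
          in proj₁ ∘ f , f∈ball , proj₂ ∘ f , chain

        -- The state carries a neighbourhood of p₀ in which all later terms lie.
        convergent-sequence :
          (∀ {s} → T s → Σ[ W ∈ Pred Carrier 0ℓ ] IsOpen W × W p₀ × (W ∩ T) ⊆ (s ∼_)) →
          Σ[ t ∈ (ℕ → Carrier) ]
            (∀ n → ball n (t n)) × (∀ n → T (t n)) × (∀ {m n} → m ℕ.< n → t m ∼ t n)
        convergent-sequence eventually =
          let f , f∈ , chain = dependentChain {S = State} {Later} {Good}
                (λ (t∈V , V′⊆V) (u∈V′ , V″⊆V′) → V′⊆V u∈V′ , V′⊆V ∘ V″⊆V′)
                (p₀ , U , open-U , _)
                (λ n (_ , V , oV , v) →
                   let t , t∈ball , t∈V , t∈T = adherent-∩ adh oV v n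
                       W , oW , w , W⊆ = eventually t∈T
                   in (t , V ∩ W , open-∩ oV oW , v , w)
                    , (t∈ball , t∈T , λ ((_ , q∈W) , q∈T) → W⊆ (q∈W , q∈T))
                    , t∈V , proj₁)
          in proj₁ ∘ f , proj₁ ∘ f∈ , proj₁ ∘ proj₂ ∘ f∈
           , λ {m} {n} m<n →
               proj₂ (proj₂ (f∈ m)) (proj₁ (chain m<n) , proj₁ (proj₂ (f∈ n)))
          where
          State : Set₁
          State = Carrier × Σ[ V ∈ Pred Carrier 0ℓ ] IsOpen V × V p₀

          Later : Rel State 0ℓ
          Later (_ , V , _) (t , V′ , _) = V t × V′ ⊆ V

          Good : ℕ → Pred State 0ℓ
          Good n (t , V , _) = ball n t × T t × (V ∩ T) ⊆ (t ∼_)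

      -- The three cases at a point where a downset fails to be open.

      module _ {y₀ : Carrier} {V : Pred Carrier 0ℓ} (oV : IsOpen V) (y₀∈V : V y₀)
               (p₀≤y₀ : p₀ ≤ y₀) (adh : Adherent (∁ (↓ V))) where
        private
          Incomparable : Rel Carrier 0ℓ
          Incomparable p q = ¬ p ≤ q × ¬ q ≤ p

          -- Otherwise `y₀` and `p₀` coincide, so `V` is a neighbourhood of `p₀` and must contain a
          -- point outside `↓ V`.
          y₀≰p₀ : ¬ y₀ ≤ p₀
          y₀≰p₀ y₀≤p₀ =
            let q , _ , q∈V , q∉↓V = adherent-∩ adh oV (subst V (≤.antisym y₀≤p₀ p₀≤y₀) y₀∈V) 0
            in q∉↓V (q , q∈V , ≤.refl)

          S : Pred Carrier 0ℓ
          S q = ¬ y₀ ≤ q × ¬ (↓ V) q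

          S-adherent : Adherent S
          S-adherent = adherent-∩ adh (≰ʳ-open {X} y₀) y₀≰p₀

          ≰p₀ : ∀ {q} → S q → ¬ q ≤ p₀
          ≰p₀ (_ , q∉↓V) q≤p₀ = q∉↓V (y₀ , y₀∈V , ≤.trans q≤p₀ p₀≤y₀)

          antichain : ∀ {t : ℕ → Carrier} → (∀ {m n} → m ℕ.< n → Incomparable (t m) (t n)) →
            ∀ {m n} → t m ≤ t n → z m ≡ z n
          antichain inc {m} {n} tm≤tn with ℕ.<-cmp m n
          ... | tri< m<n _ _  = contradiction tm≤tn (proj₁ (inc m<n))
          ... | tri≈ _ refl _ = refl
          ... | tri> _ _ n<m  = contradiction tm≤tn (proj₂ (inc n<m))

          -- Each chosen `s` is incomparable with `p₀`, so the points incomparable with `s` form an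
          -- open neighbourhood of `p₀`.
          Z₃-case : Adherent (λ q → ¬ p₀ ≤ q × S q) → ForbiddenConfiguration orderedSpace
          Z₃-case adh′ =
            let t , t∈ball , t∈ , inc = convergent-sequence {_∼_ = Incomparable} adh′
                  λ {s} (p₀≰s , s∈S) →
                      (λ q → ¬ s ≤ q × ¬ q ≤ s)
                    , open-∩ (≰ʳ-open {X} s) (≰ˡ-open {X} s)
                    , (≰p₀ s∈S , p₀≰s) , proj₁
            in sequence⇒forbidden oV y₀∈V p₀≤y₀ y₀≰p₀ t∈ball
                 (proj₂ ∘ proj₂ ∘ t∈) (proj₁ ∘ proj₂ ∘ t∈) 2F
                 (λ n → mk⇔ (λ p₀≤t → contradiction p₀≤t (proj₁ (t∈ n))) λ ())
                 (λ m n → mk⇔ (inj₂ ∘ antichain inc) λ { (inj₂ refl) → ≤.refl })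

          -- As p₀ ≤ s, the complement of ↓s is no neighbourhood of `p₀`; the ball supplied by
          -- `isolated` excludes the points of `T` below `s` in its stead.
          Z₂-case : ∀ {T} → Adherent T → T ⊆ (λ q → p₀ ≤ q × S q) →
            (∀ {s} → T s → ∃[ n ] Empty (ball n ∩ (T ∩ (_≤ s)))) →
            ForbiddenConfiguration orderedSpace
          Z₂-case adh′ T⊆ isolated =
            let t , t∈ball , t∈T , inc = convergent-sequence {_∼_ = Incomparable} adh′
                  λ {s} s∈T → let n , empty = isolated s∈T in
                      (λ q → ¬ s ≤ q × ball n q)
                    , open-∩ (≰ʳ-open {X} s) (ball-open n)
                    , (≰p₀ (proj₂ (T⊆ s∈T)) , ball-centre n)
                    , λ ((s≰q , q∈ball) , q∈T) → s≰q , λ q≤s → empty _ (q∈ball , q∈T , q≤s)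
                t∈ = T⊆ ∘ t∈T
            in sequence⇒forbidden oV y₀∈V p₀≤y₀ y₀≰p₀ t∈ball
                 (λ n → proj₂ (proj₂ (t∈ n))) (λ n → proj₁ (proj₂ (t∈ n))) 1F
                 (λ n → mk⇔ (λ _ → x<z) (λ _ → proj₁ (t∈ n)))
                 (λ m n → mk⇔ (inj₂ ∘ antichain inc) λ { (inj₂ refl) → ≤.refl })

          -- Adherence to T ∩ ↓s provides a next term below `s`; taking it in the complement of ↑s,
          -- an open neighbourhood of `p₀`, makes it strictly below.
          Z₁-case : ∀ {T} → Adherent T → T ⊆ (λ q → p₀ ≤ q × S q) →
            (∀ {s} → T s → Adherent (T ∩ (_≤ s))) →
            ForbiddenConfiguration orderedSpace
          Z₁-case {T} adh′ T⊆ recurrent =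
            let t , t∈ball , t∈T , chain = convergent-chain {_∼_ = _≻_} adh′ ≻-trans
                  λ {s} s∈T → adherent-⊆
                    (λ (s≰q , q∈T , q≤s) → q∈T , q≤s , s≰q)
                    (adherent-∩ (recurrent s∈T) (≰ʳ-open {X} s) (≰p₀ (proj₂ (T⊆ s∈T))))
                t∈ = T⊆ ∘ t∈T
            in sequence⇒forbidden oV y₀∈V p₀≤y₀ y₀≰p₀ t∈ball
                 (λ n → proj₂ (proj₂ (t∈ n))) (λ n → proj₁ (proj₂ (t∈ n))) 0F
                 (λ n → mk⇔ (λ _ → x<z) (λ _ → proj₁ (t∈ n)))
                 (λ m n → mk⇔ (reflects chain)
                                 λ { (inj₁ (z<z n<m)) → proj₁ (chain n<m)
                                   ; (inj₂ refl)      → ≤.refl })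
            where
            _≻_ : Rel Carrier 0ℓ
            s ≻ t = t ≤ s × ¬ s ≤ t

            ≻-trans : Transitive _≻_
            ≻-trans (t≤s , s≰t) (u≤t , t≰u) =
              ≤.trans u≤t t≤s , λ s≤u → s≰t (≤.trans s≤u u≤t)

            reflects : ∀ {t : ℕ → Carrier} → (∀ {m n} → m ℕ.< n → t m ≻ t n) →
              ∀ {m n} → t m ≤ t n → OrderedSpace._≤_ Z₁ (z m) (z n)
            reflects chain {m} {n} tm≤tn with ℕ.<-cmp m n
            ... | tri< m<n _ _  = contradiction tm≤tn (proj₂ (chain m<n))
            ... | tri≈ _ refl _ = inj₂ refl
            ... | tri> _ _ n<m  = inj₁ (z<z n<m)

        adherent⇒forbidden : ForbiddenConfiguration orderedSpace
        adherent⇒forbidden with adherent? (λ q → ¬ p₀ ≤ q × S q)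
        ... | inj₁ adh₃ = Z₃-case adh₃
        -- Inside `ball k` every point of `S` is above `p₀`. The next test collects the points of
        -- `T` below which `T` stays away from `p₀`.
        ... | inj₂ (k , ∅ₖ) with adherent? (λ q → T q × ∃[ n ] Empty (ball n ∩ (T ∩ (_≤ q))))
          where
          T : Pred Carrier 0ℓ
          T q = p₀ ≤ q × S q
        -- The sequence is drawn from the collected points only; the emptiness of `T` below a point
        -- in some ball passes to this subset.
        ...   | inj₁ adh₂ = Z₂-case adh₂ proj₁
                  λ (_ , n , empty) → n , λ q (q∈ball , (q∈T , _) , q≤s) →
                    empty q (q∈ball , q∈T , q≤s)
        -- `ball l` contains no collected point, so after cutting `T` down to `ball l` the part
        -- below any remaining point is still adherent to `p₀`.
        ...   | inj₂ (l , ∅ₗ) = Z₁-case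
                  (adherent-∩ T-adherent (ball-open l) (ball-centre l)) proj₂
                  λ {s} (s∈ball , s∈T) → [ (λ adh₁ → adherent-⊆
                        (λ (q∈ball , q∈T , q≤s) → (q∈ball , q∈T) , q≤s)
                        (adherent-∩ adh₁ (ball-open l) (ball-centre l)))
                    , (λ isolated → contradiction (s∈ball , s∈T , isolated) (∅ₗ s)) ]′
                    (adherent? (λ q → (p₀ ≤ q × S q) × q ≤ s))
          where
          T-adherent : Adherent (λ q → p₀ ≤ q × S q)
          T-adherent = adherent-⊆
            (λ (q∈ball , q∈S) → ¬¬-elim (λ p₀≰q → ∅ₖ _ (q∈ball , p₀≰q , q∈S)) , q∈S)
            (adherent-∩ S-adherent (ball-open k) (ball-centre k))

    ¬forbidden⇒openDownsets : (∀ p → NeighbourhoodBase topology p) →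
      ¬ ForbiddenConfiguration orderedSpace → OpenDownsets orderedSpace
    ¬forbidden⇒openDownsets base ¬forbidden {V} oV = open-pointwise topology
      λ {p} (q , q∈V , p≤q) →
        [ (λ adh → contradiction (adherent⇒forbidden (base p) oV q∈V p≤q adh) ¬forbidden)
        , (λ (n , empty) → let open NeighbourhoodBase (base p) in
             ball n , ball-open n , ball-centre n
           , λ {r} r∈ball → ¬¬-elim λ r∉↓V → empty r (r∈ball , r∉↓V)) ]′
        (adherent? (base p) (∁ (↓ V)))

-- Order reversal and the characterisation.

module _ {Y X : OrderedSpace} where

  embedding* : Embedding Y (X *) → Embedding (Y *) X
  embedding* e = record
    { to = to ; injective = injective ; continuous = continuous ; induced = induced
    ; order = order }
    where open Embedding e

  embedding*⁻¹ : Embedding (Y *) X → Embedding Y (X *)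
  embedding*⁻¹ e = record
    { to = to ; injective = injective ; continuous = continuous ; induced = induced
    ; order = order }
    where open Embedding e

corollary3p7 : (em : ∀ ℓ → ExcludedMiddle ℓ) →
    (X : PriestleySpace) → let open PriestleySpace X in
    Metrizable topology →
    (¬ DualToBiHeyting (em 0ℓ) X)
    ⇔ ( (Σ[ i ∈ Fin 3 ] Σ[ e ∈ Embedding (Z i) orderedSpace ]
    let open Embedding e in
    Σ[ U ∈ Pred Carrier 0ℓ ]
    IsOpen U × U (to y) × (to ⊢ (↓ U)) ≐ (｛ x ｝ ∪ ｛ y ｝))
    ⊎ (Σ[ i ∈ Fin 3 ] Σ[ e ∈ Embedding (Z i *) orderedSpace ]
    let open Embedding e in
    Σ[ U ∈ Pred Carrier 0ℓ ]
    IsOpen U × U (to y) × (to ⊢ (↑ U)) ≐ (｛ x ｝ ∪ ｛ y ｝)))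
corollary3p7 em X metrizable = mk⇔
  (λ ¬biHeyting → ¬¬-elim em λ ¬forbidden → ¬biHeyting
    ( openDownsets⇒heyting em (¬forbidden⇒openDownsets em {X} base (¬forbidden ∘ inj₁))
    -- Upsets in `X` are downsets in `dual X`, and a copy of `Z i` there is a copy of `Z i *` in
    -- `X`.
    , openUpsets⇒coheyting em (¬forbidden⇒openDownsets em {dual em X} base
        (λ (i , e , rest) → ¬forbidden (inj₂ (i , embedding* e , rest))))))
  [ (λ forbidden ((_ , heyting) , _) →
       forbidden⇒¬openDownsets forbidden (heyting⇒openDownsets em heyting))
  , (λ (i , e , rest) (_ , (_ , coheyting)) →
       forbidden⇒¬openDownsets {X = orderedSpace *} (i , embedding*⁻¹ e , rest)
         (coheyting⇒openUpsets em coheyting)) ]′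
  where
  open PriestleySpace X
  base = metrizable⇒neighbourhoodBase metrizable
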